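{- Let $A\in\mathbb{R}^{r\times n}$ be a configuration of rank $r$ with columns $a_1,\dots,a_n$, and let $S\subseteq[n]$ be right-completable to (the zero-set of) a cocircuit $C_0^*$ of $A$. Then: (i) For the set $R:=\{i\in[n]: i>\max S\}$ the rank bound $\operatorname{rank}(A_{S\cup R})\ge r-1$ holds. (ii) For all $i\in[n]\setminus S$ with $i<\max S$ the rank bound $\operatorname{rank}(A_S)<\operatorname{rank}(A_{S\cup\{i\}})$ holds.
   Context: $[n]=\{1,\dots,n\}$. For $S\subseteq[n]$, $A_S$ denotes the submatrix of the columns with indices in $S$. $S$ is coplanar if $\operatorname{rank}(A_S)<r$. A cocircuit (its zero part) is an inclusion-maximal coplanar subset of $[n]$. $S$ is right-completable to $C_0^*$ if $S\subseteq C_0^*$ and every element of $C_0^*\setminus S$ is larger than every element of $S$. For $S=\emptyset$ the conventions are that $R=[n]$ and (ii) is void. -}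

module Defs where

open import Algebra.Bundles.Raw using (RawRing)
import Algebra.Definitions.RawMonoid as RawMonoidDefinitions
open import Axiom.ExcludedMiddle using (ExcludedMiddle)
open import Data.Bool.Base using (if_then_else_)
open import Data.Fin.Base as Fin using (Fin)
import Data.Fin.Properties as Fin
open import Data.Fin.Subset using (Subset; _∈_; _∉_; _⊆_; ⊤; inside; outside)
open import Data.Fin.Subset.Properties using (_∈?_)
open import Data.List.Base using (List; length; lookup; filter; allFin)
open import Data.Maybe.Base using (Maybe; just; nothing)
open import Data.Nat.Base as ℕ using (ℕ; zero; suc)
import Data.Nat.Properties as ℕ
open import Data.Product.Base using (∃; _×_; _,_)
open import Data.Rational.Base
  using (ℚ; 0ℚ; 1ℚ; ½; _<_; _≤_; _+_; _-_; _*_; -_; ∣_∣; 1/_; Positive; NonZero; positive; nonNegative)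
open import Data.Rational.Properties
open import Data.Rational.Solver using (module +-*-Solver)
open import Data.Vec.Base using ([]; _∷_; tabulate)
open import Level using (0ℓ; _⊔_)
open import Relation.Binary.PropositionalEquality
open import Relation.Nullary.Decidable.Core using (does)

------------------------------------------------------------------------
-- The real numbers, as Cauchy sequences of rationals up to null sequences

Close : (ℕ → ℚ) → ℚ → Set
Close x ε = ∃ λ N → ∀ m n → N ℕ.≤ m → N ℕ.≤ n → ∣ x m - x n ∣ < ε

IsCauchy : (ℕ → ℚ) → Set
IsCauchy x = ∀ ε → 0ℚ < ε → Close x ε

EventuallyBounded : (ℕ → ℚ) → Set
EventuallyBounded x = ∃ λ B → 0ℚ < B × ∃ λ N → ∀ n → N ℕ.≤ n → ∣ x n ∣ ≤ B

record ℝ : Set where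
  constructor mkℝ
  field
    seq    : ℕ → ℚ
    cauchy : IsCauchy seq

open ℝ public

infix  4 _≈ℝ_
infixl 6 _+ℝ_
infixl 7 _*ℝ_
infix  8 -ℝ_

_≈ℝ_ : ℝ → ℝ → Set
x ≈ℝ y = ∀ ε → 0ℚ < ε → ∃ λ N → ∀ n → N ℕ.≤ n → ∣ seq x n - seq y n ∣ < ε

module CauchySequences where

  -- Opaque, so that equality of reals never unfolds Cauchy proofs.
  abstract
    halves : ∀ ε → ½ * ε + ½ * ε ≡ ε
    halves ε = trans (sym (*-distribʳ-+ ε ½ ½)) (*-identityˡ ε)

    0<½* : ∀ {ε} → 0ℚ < ε → 0ℚ < ½ * ε
    0<½* {ε} 0<ε = subst (_< ½ * ε) (*-zeroʳ ½) (*-monoʳ-<-pos ½ 0<ε)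

    +-cauchy : ∀ {x y} → IsCauchy x → IsCauchy y → IsCauchy (λ n → x n + y n)
    +-cauchy {x} {y} cx cy ε 0<ε with cx (½ * ε) (0<½* 0<ε) | cy (½ * ε) (0<½* 0<ε)
    ... | N , hx | M , hy = N ℕ.⊔ M , λ m n N≤m N≤n → begin-strict
      ∣ (x m + y m) - (x n + y n) ∣
        ≡⟨ cong ∣_∣ (solve 4 (λ a b c d → (a :+ b) :- (c :+ d) := (a :- c) :+ (b :- d))
                       refl (x m) (y m) (x n) (y n)) ⟩
      ∣ (x m - x n) + (y m - y n) ∣    ≤⟨ ∣p+q∣≤∣p∣+∣q∣ (x m - x n) (y m - y n) ⟩
      ∣ x m - x n ∣ + ∣ y m - y n ∣
        <⟨ +-mono-< (hx m n (ℕ.m⊔n≤o⇒m≤o N M N≤m) (ℕ.m⊔n≤o⇒m≤o N M N≤n))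
                    (hy m n (ℕ.m⊔n≤o⇒n≤o N M N≤m) (ℕ.m⊔n≤o⇒n≤o N M N≤n)) ⟩
      ½ * ε + ½ * ε                    ≡⟨ halves ε ⟩
      ε                                ∎
      where open ≤-Reasoning
            open +-*-Solver

    neg-cauchy : ∀ {x} → IsCauchy x → IsCauchy (λ n → - x n)
    neg-cauchy {x} cx ε 0<ε with cx ε 0<ε
    ... | N , hx = N , λ m n N≤m N≤n →
      subst (_< ε)
        (trans (sym (∣-p∣≡∣p∣ (x m - x n)))
               (cong ∣_∣ (neg-distrib-+ (x m) (- x n))))
        (hx m n N≤m N≤n)

    const-cauchy : ∀ q → IsCauchy (λ _ → q)
    const-cauchy q ε 0<ε =
      0 , λ _ _ _ _ → subst (_< ε) (cong ∣_∣ (sym (+-inverseʳ q))) 0<ε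

    eventually-bounded : ∀ {x} → IsCauchy x → EventuallyBounded x
    eventually-bounded {x} cx with cx 1ℚ (positive⁻¹ 1ℚ)
    ... | N , hx = 1ℚ + ∣ x N ∣ , +-mono-<-≤ (positive⁻¹ 1ℚ) (0≤∣p∣ (x N)) , N , λ n N≤n → begin
      ∣ x n ∣                      ≡⟨ cong ∣_∣ (solve 2 (λ a b → a := (a :- b) :+ b) refl (x n) (x N)) ⟩
      ∣ (x n - x N) + x N ∣        ≤⟨ ∣p+q∣≤∣p∣+∣q∣ (x n - x N) (x N) ⟩
      ∣ x n - x N ∣ + ∣ x N ∣      ≤⟨ +-monoˡ-≤ ∣ x N ∣ (<⇒≤ (hx n N N≤n ℕ.≤-refl)) ⟩
      1ℚ + ∣ x N ∣                 ∎
      where open ≤-Reasoning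
            open +-*-Solver

    *-bound : ∀ {a B d δ} → 0ℚ < B → 0ℚ ≤ d → a ≤ B → d < δ → a * d < B * δ
    *-bound {a} {B} {d} {δ} 0<B 0≤d a≤B d<δ =
      ≤-<-trans (*-monoʳ-≤-nonNeg d {{nonNegative 0≤d}} a≤B)
                (*-monoʳ-<-pos B {{positive 0<B}} d<δ)

    scale : ∀ {D ε} → 0ℚ < D → 0ℚ < ε → ∃ λ δ → 0ℚ < δ × D * δ ≡ ε
    scale {D} {ε} 0<D 0<ε =
      1/ D * ε ,
      subst (_< 1/ D * ε) (*-zeroʳ (1/ D)) (*-monoʳ-<-pos (1/ D) {{1/pos⇒pos D}} 0<ε) ,
      trans (sym (*-assoc D (1/ D) ε)) (trans (cong (_* ε) (*-inverseʳ D)) (*-identityˡ ε))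
      where
      instance
        D-pos : Positive D
        D-pos = positive 0<D

        D-nonZero : NonZero D
        D-nonZero = pos⇒nonZero D

    *-difference : ∀ a b c d → a * b - c * d ≡ a * (b - d) + d * (a - c)
    *-difference = solve 4 (λ a b c d → a :* b :- c :* d := a :* (b :- d) :+ d :* (a :- c)) refl
      where open +-*-Solver

    *-close : ∀ {B C δ ε} a b c d → 0ℚ < B → 0ℚ < C → (B + C) * δ ≡ ε →
              ∣ a ∣ ≤ B → ∣ d ∣ ≤ C → ∣ b - d ∣ < δ → ∣ a - c ∣ < δ → ∣ a * b - c * d ∣ < ε
    *-close {B} {C} {δ} {ε} a b c d 0<B 0<C total a≤B d≤C b-d<δ a-c<δ = begin-strict
      ∣ a * b - c * d ∣                        ≡⟨ cong ∣_∣ (*-difference a b c d) ⟩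
      ∣ a * (b - d) + d * (a - c) ∣            ≤⟨ ∣p+q∣≤∣p∣+∣q∣ (a * (b - d)) (d * (a - c)) ⟩
      ∣ a * (b - d) ∣ + ∣ d * (a - c) ∣
        ≡⟨ cong₂ _+_ (∣p*q∣≡∣p∣*∣q∣ a (b - d)) (∣p*q∣≡∣p∣*∣q∣ d (a - c)) ⟩
      ∣ a ∣ * ∣ b - d ∣ + ∣ d ∣ * ∣ a - c ∣
        <⟨ +-mono-< (*-bound 0<B (0≤∣p∣ (b - d)) a≤B b-d<δ) (*-bound 0<C (0≤∣p∣ (a - c)) d≤C a-c<δ) ⟩
      B * δ + C * δ                            ≡⟨ sym (*-distribʳ-+ δ B C) ⟩
      (B + C) * δ                              ≡⟨ total ⟩
      ε                                        ∎
      where open ≤-Reasoning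

    *-cauchy : ∀ {x y} → IsCauchy x → IsCauchy y → IsCauchy (λ n → x n * y n)
    *-cauchy {x} {y} cx cy ε 0<ε = bounded (eventually-bounded {x} cx) (eventually-bounded {y} cy)
      where
      bounded : EventuallyBounded x → EventuallyBounded y → Close (λ n → x n * y n) ε
      bounded (B , 0<B , N₁ , bx) (C , 0<C , N₂ , by) = scaled (scale (+-mono-< 0<B 0<C) 0<ε)
        where
        close : ∀ δ → (B + C) * δ ≡ ε → Close x δ → Close y δ → Close (λ n → x n * y n) ε
        close δ total (N₃ , hx) (N₄ , hy) = (N₁ ℕ.⊔ N₂) ℕ.⊔ (N₃ ℕ.⊔ N₄) , λ m n N≤m N≤n →
          let m≥₁₂ = ℕ.m⊔n≤o⇒m≤o (N₁ ℕ.⊔ N₂) (N₃ ℕ.⊔ N₄) N≤m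
              n≥₁₂ = ℕ.m⊔n≤o⇒m≤o (N₁ ℕ.⊔ N₂) (N₃ ℕ.⊔ N₄) N≤n
              m≥₃₄ = ℕ.m⊔n≤o⇒n≤o (N₁ ℕ.⊔ N₂) (N₃ ℕ.⊔ N₄) N≤m
              n≥₃₄ = ℕ.m⊔n≤o⇒n≤o (N₁ ℕ.⊔ N₂) (N₃ ℕ.⊔ N₄) N≤n
          in *-close (x m) (y m) (x n) (y n) 0<B 0<C total
               (bx m (ℕ.m⊔n≤o⇒m≤o N₁ N₂ m≥₁₂))
               (by n (ℕ.m⊔n≤o⇒n≤o N₁ N₂ n≥₁₂))
               (hy m n (ℕ.m⊔n≤o⇒n≤o N₃ N₄ m≥₃₄) (ℕ.m⊔n≤o⇒n≤o N₃ N₄ n≥₃₄))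
               (hx m n (ℕ.m⊔n≤o⇒m≤o N₃ N₄ m≥₃₄) (ℕ.m⊔n≤o⇒m≤o N₃ N₄ n≥₃₄))

        scaled : (∃ λ δ → 0ℚ < δ × (B + C) * δ ≡ ε) → Close (λ n → x n * y n) ε
        scaled (δ , 0<δ , total) = close δ total (cx δ 0<δ) (cy δ 0<δ)

open CauchySequences

fromℚ : ℚ → ℝ
fromℚ q = mkℝ (λ _ → q) (const-cauchy q)

_+ℝ_ : ℝ → ℝ → ℝ
x +ℝ y = mkℝ (λ n → seq x n + seq y n) (+-cauchy {seq x} {seq y} (cauchy x) (cauchy y))

_*ℝ_ : ℝ → ℝ → ℝ
x *ℝ y = mkℝ (λ n → seq x n * seq y n) (*-cauchy {seq x} {seq y} (cauchy x) (cauchy y))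

-ℝ_ : ℝ → ℝ
-ℝ x = mkℝ (λ n → - seq x n) (neg-cauchy {seq x} (cauchy x))

ℝ-rawRing : RawRing 0ℓ 0ℓ
ℝ-rawRing = record
  { Carrier = ℝ
  ; _≈_     = _≈ℝ_
  ; _+_     = _+ℝ_
  ; _*_     = _*ℝ_
  ; -_      = -ℝ_
  ; 0#      = fromℚ 0ℚ
  ; 1#      = fromℚ 1ℚ
  }

------------------------------------------------------------------------
-- Ordered index sets

elements : ∀ {n} → Subset n → List (Fin n)
elements S = filter (_∈? S) (allFin _)

-- nothing is the maximum of the empty set
max : ∀ {n} → Subset n → Maybe (Fin n)
max []      = nothing
max (b ∷ S) with max S
... | just m  = just (Fin.suc m)
max (inside  ∷ S) | nothing = just Fin.zero
max (outside ∷ S) | nothing = nothing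

-- {i ∣ i > m}, read as the whole index set if there is no m
above : ∀ {n} → Maybe (Fin n) → Subset n
above nothing  = ⊤
above (just m) = tabulate λ i → does (m Fin.<? i)

RightCompletable : ∀ {n} → Subset n → Subset n → Set
RightCompletable S C = S ⊆ C × (∀ {i j} → i ∈ C → i ∉ S → j ∈ S → j Fin.< i)

------------------------------------------------------------------------
-- Matrices, rank and cocircuits

module LinearAlgebra {c ℓ} (K : RawRing c ℓ) where
  private module K = RawRing K
  open RawMonoidDefinitions K.+-rawMonoid using (sum)

  Matrix : ℕ → ℕ → Set c
  Matrix r n = Fin r → Fin n → K.Carrier

  LinearlyIndependentColumns : ∀ {r n} → Matrix r n → Set (c ⊔ ℓ)
  LinearlyIndependentColumns {r} {n} A =
    (x : Fin n → K.Carrier) →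
    (∀ i → sum (λ j → x j K.* A i j) K.≈ K.0#) →
    ∀ j → x j K.≈ K.0#

  -- The choice of columns need not be assumed injective: over a nontrivial
  -- ring, repeated columns are linearly dependent.
  HasIndependentColumns : ∀ {r n} → Matrix r n → ℕ → Set (c ⊔ ℓ)
  HasIndependentColumns {r} {n} A k =
    ∃ λ (f : Fin k → Fin n) → LinearlyIndependentColumns (λ i j → A i (f j))

  submatrix : ∀ {r n} → Matrix r n → (S : Subset n) → Matrix r (length (elements S))
  submatrix A S i j = A i (lookup (elements S) j)

  -- Rank is only computable classically, hence the excluded middle.
  module Rank (em : ExcludedMiddle (c ⊔ ℓ)) where

    -- the largest k ≤ b such that P k, or 0 if there is none
    largest : (P : ℕ → Set (c ⊔ ℓ)) → ℕ → ℕ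
    largest P zero    = 0
    largest P (suc b) = if does (em {P (suc b)}) then suc b else largest P b

    rank : ∀ {r n} → Matrix r n → ℕ
    rank {r} {n} A = largest (HasIndependentColumns A) n

    Coplanar : ∀ {r n} → Matrix r n → Subset n → Set
    Coplanar {r} A S = rank (submatrix A S) ℕ.< r

    -- Cocircuits are represented by their zero sets.
    Cocircuit : ∀ {r n} → Matrix r n → Subset n → Set
    Cocircuit A C = Coplanar A C × (∀ D → Coplanar A D → C ⊆ D → D ≡ C)

module RealMatrices = LinearAlgebra ℝ-rawRing

{-# OPTIONS --safe #-}

-- A cocircuit C₀ is a proper subset of [n], and by maximality adding any
-- i ∉ C₀ raises its rank to r.  Adding one column raises the rank by at most
-- one, so rank C₀ ≥ r − 1; as C₀ ⊆ S ∪ R, this gives (i).  In (ii), i ∉ C₀,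
-- since all elements of C₀ ∖ S exceed max S.  So adding i raises the rank of
-- C₀, and hence, by diminishing returns of the rank, that of S ⊆ C₀.

module Submission where

open import Defs
open import Algebra.Bundles using (CommutativeRing)
import Algebra.Properties.Ring as RingProperties
import Algebra.Properties.Semiring.Sum as SemiringSum
open import Axiom.ExcludedMiddle using (ExcludedMiddle)
open import Data.Fin.Base using (Fin; zero; suc; punchIn; _<_)
import Data.Fin.Properties as Fin
open import Data.Fin.Subset using (Subset; inside; outside; _∈_; _∉_; _⊆_; _∪_; ⁅_⁆)
open import Data.Fin.Subset.Properties
  using (_∈?_; ∈⊤; x∈p∪q⁻; p⊆p∪q; q⊆p∪q; x∈⁅x⁆; x∈⁅y⁆⇒x≡y)
open import Data.List.Base using (lookup; allFin)
open import Data.List.Membership.Propositional.Properties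
  using (∈-filter⁺; ∈-filter⁻; ∈-allFin; ∈-lookup)
open import Data.List.Relation.Unary.Any using (index)
open import Data.List.Relation.Unary.Any.Properties using (lookup-index)
open import Data.Maybe.Base using (just; nothing)
open import Data.Nat.Base as ℕ using (ℕ; zero; suc; s≤s)
import Data.Nat.Properties as ℕ
open import Data.Product.Base using (∃; _×_; _,_; proj₁; proj₂)
open import Data.Rational.Base as ℚ using (ℚ; 0ℚ; 1ℚ; ½; ∣_∣; 1/_; positive; nonNegative)
import Data.Rational.Properties as ℚ
open import Data.Rational.Solver using (module +-*-Solver)
open import Data.Sum.Base using (_⊎_; inj₁; inj₂; [_,_]′)
import Data.Vec.Base as Vec
open import Data.Vec.Functional using (_∷_; insertAt)
open import Data.Vec.Functional.Properties using (insertAt-lookup; insertAt-punchIn)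
import Data.Vec.Properties as Vec
open import Function.Base using (_∘_; id)
open import Level using (0ℓ; _⊔_)
open import Relation.Binary.PropositionalEquality as ≡ using (_≡_; refl)
import Relation.Binary.Reasoning.Setoid as SetoidReasoning
open import Relation.Nullary using (¬_; yes; no; contradiction)
open import Relation.Nullary.Decidable using (dec-true)
open CauchySequences

-- Linear algebra over a field

-- The field property takes the form of a case distinction on each element, since this is how pivots
-- and leading coefficients are treated below.
record IsField {c ℓ} (K : CommutativeRing c ℓ) : Set (c ⊔ ℓ) where
  open CommutativeRing K
  field
    1≉0              : ¬ 1# ≈ 0#
    zeroOrInvertible : ∀ x → x ≈ 0# ⊎ ∃ λ y → x * y ≈ 1#

module FieldRank {c ℓ} (K : CommutativeRing c ℓ) (isField : IsField K)
                 (em : ExcludedMiddle (c ⊔ ℓ)) where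

  open CommutativeRing K hiding (zero)
  open IsField isField
  open RingProperties ring using (-‿distribˡ-*; -‿distribʳ-*; +-inverseˡ-unique)
  open SemiringSum semiring using
    ( sum; sum-cong-≋; sum-remove; sum-replicate-zero
    ; ∑-distrib-+; ∑-comm; *-distribˡ-sum; *-distribʳ-sum )
  open LinearAlgebra rawRing
  open Rank em
  open SetoidReasoning setoid

  sum-zero : ∀ {n} (t : Fin n → Carrier) → (∀ j → t j ≈ 0#) → sum t ≈ 0#
  sum-zero {n} t t≈0 = trans (sum-cong-≋ t≈0) (sum-replicate-zero n)

  zero-row : ∀ {n} (x b : Fin n → Carrier) → (∀ j → b j ≈ 0#) → sum (λ j → x j * b j) ≈ 0#
  zero-row x b b≈0 = sum-zero _ λ j → trans (*-congˡ (b≈0 j)) (zeroʳ (x j))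

  -- Eliminating with pivot column p: a combination of the columns
  -- b_j + u_j b_p (j ≠ p) is one of the original columns b_j.
  insertAt-combination : ∀ {n} (y u : Fin n → Carrier) p (b : Fin (suc n) → Carrier) →
    sum (λ j → insertAt y p (sum (λ l → y l * u l)) j * b j) ≈
    sum (λ j → y j * (b (punchIn p j) + u j * b p))
  insertAt-combination y u p b = begin
    sum (λ j → x j * b j)
      ≈⟨ sum-remove {i = p} (λ j → x j * b j) ⟩
    x p * b p + sum (λ j → x (punchIn p j) * b (punchIn p j))
      ≈⟨ +-cong (*-congʳ (reflexive (insertAt-lookup y p t)))
                (sum-cong-≋ λ j → *-congʳ (reflexive (insertAt-punchIn y p t j))) ⟩
    t * b p + sum (λ j → y j * b (punchIn p j))
      ≈⟨ +-comm _ _ ⟩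
    sum (λ j → y j * b (punchIn p j)) + t * b p
      ≈⟨ +-congˡ (*-distribʳ-sum (b p) (λ l → y l * u l)) ⟩
    sum (λ j → y j * b (punchIn p j)) + sum (λ j → y j * u j * b p)
      ≈⟨ ∑-distrib-+ (λ j → y j * b (punchIn p j)) (λ j → y j * u j * b p) ⟨
    sum (λ j → y j * b (punchIn p j) + y j * u j * b p)
      ≈⟨ sum-cong-≋ (λ j → trans (+-congˡ (*-assoc (y j) (u j) (b p))) (sym (distribˡ (y j) _ _))) ⟩
    sum (λ j → y j * (b (punchIn p j) + u j * b p))   ∎
    where
    t = sum (λ l → y l * u l)
    x = insertAt y p t

  wide-dependent : ∀ {r n} (A : Matrix r n) → r ℕ.< n → ¬ LinearlyIndependentColumns A
  wide-dependent {zero}  {suc n} A _           indep = 1≉0 (indep (λ _ → 1#) (λ ()) zero)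
  wide-dependent {suc r} {suc n} A (s≤s r<n) indep with Fin.any? (λ p → em {∃ λ q → A zero p * q ≈ 1#})
  ... | no no-pivot = wide-dependent (λ i → A (suc i)) (ℕ.m<n⇒m<1+n r<n) λ x x-kernel →
        indep x λ { zero    → zero-row x (A zero) row-zero
                  ; (suc i) → x-kernel i }
    where
    row-zero : ∀ j → A zero j ≈ 0#
    row-zero j = [ id , (λ inv → contradiction (j , inv) no-pivot) ]′ (zeroOrInvertible (A zero j))
  ... | yes (p , q , pq≈1) = wide-dependent A′ r<n λ y y-kernel j →
        -- A kernel vector `y` of `A′` extends to one of `A` by a suitable entry at `p`; away from
        -- `p` the entries are those of `y`.
        trans (reflexive (≡.sym (insertAt-punchIn y p _ j)))
          (indep (insertAt y p _)
            (λ { zero    → trans (insertAt-combination y u p (A zero)) (zero-row y _ cleared)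
               ; (suc i) → trans (insertAt-combination y u p (A (suc i))) (y-kernel i) })
            (punchIn p j))
    where
    -- The multiple of the pivot column that cancels the first entry of column `punchIn p j`; `q` is
    -- the inverse of the pivot.
    u : Fin n → Carrier
    u j = - (A zero (punchIn p j) * q)

    A′ : Matrix r n
    A′ i j = A (suc i) (punchIn p j) + u j * A (suc i) p

    cleared : ∀ j → A zero (punchIn p j) + u j * A zero p ≈ 0#
    cleared j = begin
      a + - (a * q) * A zero p    ≈⟨ +-congˡ (-‿distribˡ-* (a * q) (A zero p)) ⟨
      a + - (a * q * A zero p)    ≈⟨ +-congˡ (-‿cong (*-assoc a q (A zero p))) ⟩
      a + - (a * (q * A zero p))  ≈⟨ +-congˡ (-‿cong (*-congˡ (trans (*-comm q _) pq≈1))) ⟩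
      a + - (a * 1#)              ≈⟨ +-congˡ (-‿cong (*-identityʳ a)) ⟩
      a + - a                     ≈⟨ -‿inverseʳ a ⟩
      0#                          ∎
      where a = A zero (punchIn p j)

  0*a+s≈s : ∀ a s → 0# * a + s ≈ s
  0*a+s≈s a s = trans (+-congʳ (zeroˡ a)) (+-identityˡ s)

  -- Associativity of the product of a row, a matrix and a column, by exchanging the two sums. It
  -- expands a combination of combinations.
  sum-*-sum : ∀ {m k} (y : Fin m → Carrier) (a : Fin m → Fin k → Carrier) (v : Fin k → Carrier) →
    sum (λ j → y j * sum (λ l → a j l * v l)) ≈ sum (λ l → sum (λ j → y j * a j l) * v l)
  sum-*-sum y a v = begin
    sum (λ j → y j * sum (λ l → a j l * v l))
      ≈⟨ sum-cong-≋ (λ j → *-distribˡ-sum (y j) (λ l → a j l * v l)) ⟩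
    sum (λ j → sum (λ l → y j * (a j l * v l)))
      ≈⟨ ∑-comm (λ j l → y j * (a j l * v l)) ⟩
    sum (λ l → sum (λ j → y j * (a j l * v l)))
      ≈⟨ sum-cong-≋ (λ l → sum-cong-≋ (λ j → *-assoc (y j) (a j l) (v l))) ⟨
    sum (λ l → sum (λ j → y j * a j l * v l))
      ≈⟨ sum-cong-≋ (λ l → *-distribʳ-sum (v l) (λ j → y j * a j l)) ⟨
    sum (λ l → sum (λ j → y j * a j l) * v l)   ∎

  -- Independence and span of families of columns

  module _ {r n : ℕ} (A : Matrix r n) where

    Independent : ∀ {k} → (Fin k → Fin n) → Set (c ⊔ ℓ)
    Independent f = LinearlyIndependentColumns (λ i j → A i (f j))

    record InSpan {k} (f : Fin k → Fin n) (x : Fin n) : Set (c ⊔ ℓ) where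
      constructor _,_
      field
        coefficient : Fin k → Carrier
        combination : ∀ i → A i x ≈ sum (λ l → coefficient l * A i (f l))

    open InSpan

    independent-resp-≗ : ∀ {k} {f g : Fin k → Fin n} → (∀ j → f j ≡ g j) → Independent f → Independent g
    independent-resp-≗ f≗g f-indep x x-kernel = f-indep x λ i →
      trans (sum-cong-≋ λ j → *-congˡ (reflexive (≡.cong (A i) (f≗g j)))) (x-kernel i)

    -- In a relation among `x ∷ f`, an invertible coefficient of `x` would allow solving for `x` and
    -- put it in the span of `f`. So that coefficient is zero, and what remains is a relation among
    -- `f`.
    independent-insert : ∀ {k x} {f : Fin k → Fin n} → Independent f → ¬ InSpan f x → Independent (x ∷ f)
    independent-insert {k} {x} {f} f-indep x∉span y y-kernel =
      [ head-zero , (λ (q , yq≈1) → contradiction (spanned q yq≈1) x∉span) ]′ (zeroOrInvertible (y zero))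
      where
      head-zero : y zero ≈ 0# → ∀ j → y j ≈ 0#
      head-zero y₀≈0 zero    = y₀≈0
      head-zero y₀≈0 (suc j) = f-indep (y ∘ suc) (λ i → begin
        sum (λ l → y (suc l) * A i (f l))                     ≈⟨ 0*a+s≈s (A i x) _ ⟨
        0# * A i x + sum (λ l → y (suc l) * A i (f l))        ≈⟨ +-congʳ (*-congʳ y₀≈0) ⟨
        y zero * A i x + sum (λ l → y (suc l) * A i (f l))    ≈⟨ y-kernel i ⟩
        0#                                                    ∎) j

      spanned : ∀ q → y zero * q ≈ 1# → InSpan f x
      spanned q yq≈1 = (λ l → - q * y (suc l)) , λ i → begin
        A i x
          ≈⟨ *-identityˡ (A i x) ⟨
        1# * A i x
          ≈⟨ *-congʳ (trans (*-comm q _) yq≈1) ⟨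
        q * y zero * A i x
          ≈⟨ *-assoc q (y zero) (A i x) ⟩
        q * (y zero * A i x)
          ≈⟨ *-congˡ (+-inverseˡ-unique _ _ (y-kernel i)) ⟩
        q * - sum (λ l → y (suc l) * A i (f l))
          ≈⟨ -‿distribʳ-* q _ ⟨
        - (q * sum (λ l → y (suc l) * A i (f l)))
          ≈⟨ -‿distribˡ-* q _ ⟩
        - q * sum (λ l → y (suc l) * A i (f l))
          ≈⟨ *-distribˡ-sum (- q) (λ l → y (suc l) * A i (f l)) ⟩
        sum (λ l → - q * (y (suc l) * A i (f l)))
          ≈⟨ sum-cong-≋ (λ l → *-assoc (- q) (y (suc l)) (A i (f l))) ⟨
        sum (λ l → - q * y (suc l) * A i (f l))
          ∎

    inSpan-head : ∀ {k} x (f : Fin k → Fin n) → InSpan (x ∷ f) x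
    inSpan-head x f = 1# ∷ (λ _ → 0#) , λ i → sym (begin
      1# * A i x + sum (λ l → 0# * A i (f l))
        ≈⟨ +-cong (*-identityˡ _) (sum-zero _ (λ l → zeroˡ (A i (f l)))) ⟩
      A i x + 0#                                ≈⟨ +-identityʳ _ ⟩
      A i x                                     ∎)

    inSpan-tail : ∀ {k x} y {f : Fin k → Fin n} → InSpan f x → InSpan (y ∷ f) x
    inSpan-tail y (a , x≈) = 0# ∷ a , λ i → trans (x≈ i) (sym (0*a+s≈s _ _))

    inSpan-member : ∀ {k} (f : Fin k → Fin n) j → InSpan f (f j)
    -- `f` and `f zero ∷ f ∘ suc` agree only pointwise, so the witness is repacked; the two sums
    -- unfold to the same term.
    inSpan-member f zero with inSpan-head (f zero) (f ∘ suc)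
    ... | a , x≈ = a , x≈
    inSpan-member f (suc j) with inSpan-tail (f zero) (inSpan-member (f ∘ suc) j)
    ... | a , x≈ = a , x≈

    inSpan-trans : ∀ {k m x} {f : Fin k → Fin n} {g : Fin m → Fin n} →
                   InSpan g x → (∀ j → InSpan f (g j)) → InSpan f x
    inSpan-trans {f = f} {g} (b , x≈) g-spanned =
      (λ l → sum (λ j → b j * coefficient (g-spanned j) l)) , λ i →
      trans (x≈ i) (trans (sum-cong-≋ λ j → *-congˡ (combination (g-spanned j) i))
                          (sum-*-sum b (λ j → coefficient (g-spanned j)) (λ l → A i (f l))))

    -- The coefficients expressing `g` through `f` form a matrix with more columns than rows. Each
    -- of its kernel vectors is a relation among `g`, so independence of `g` would make its columns
    -- independent as well.
    spanned-dependent : ∀ {k m} {f : Fin k → Fin n} {g : Fin m → Fin n} → k ℕ.< m →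
                        (∀ j → InSpan f (g j)) → ¬ Independent g
    spanned-dependent {f = f} {g} k<m g-spanned g-indep =
      wide-dependent (λ l j → coefficient (g-spanned j) l) k<m λ y y-kernel → g-indep y λ i → begin
        sum (λ j → y j * A i (g j))
          ≈⟨ sum-cong-≋ (λ j → *-congˡ (combination (g-spanned j) i)) ⟩
        sum (λ j → y j * sum (λ l → coefficient (g-spanned j) l * A i (f l)))
          ≈⟨ sum-*-sum y (λ j → coefficient (g-spanned j)) (λ l → A i (f l)) ⟩
        sum (λ l → sum (λ j → y j * coefficient (g-spanned j) l) * A i (f l))
          ≈⟨ sum-zero _ (λ l → trans (*-congʳ (y-kernel l)) (zeroˡ (A i (f l)))) ⟩
        0# ∎

  -- Rank and bases of sets of columns

  largest-upper : ∀ (P : ℕ → Set (c ⊔ ℓ)) {k b} → P k → k ℕ.≤ b → k ℕ.≤ largest P b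
  largest-upper P {b = zero}  _  k≤0 = k≤0
  largest-upper P {b = suc b} Pk k≤b with em {P (suc b)}
  ... | yes _  = k≤b
  ... | no ¬P with ℕ.m≤n⇒m<n∨m≡n k≤b
  ...   | inj₁ (s≤s k≤b) = largest-upper P Pk k≤b
  ...   | inj₂ ≡.refl    = contradiction Pk ¬P

  -- The search falls back on 0, hence the hypothesis `P 0`.
  largest-satisfies : ∀ (P : ℕ → Set (c ⊔ ℓ)) b → P 0 → P (largest P b)
  largest-satisfies P zero    P0 = P0
  largest-satisfies P (suc b) P0 with em {P (suc b)}
  ... | yes Pb = Pb
  ... | no _   = largest-satisfies P b P0

  -- The search for the rank starts at `n`. It misses no larger family, because the `n` columns,
  -- listed by `id`, span every family.
  rank-upper : ∀ {r n k} (A : Matrix r n) → HasIndependentColumns A k → k ℕ.≤ rank A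
  rank-upper A (f , f-indep) = largest-upper (HasIndependentColumns A) (f , f-indep) (ℕ.≮⇒≥ λ n<k →
    spanned-dependent A n<k (λ j → inSpan-member A id (f j)) f-indep)

  rank-attained : ∀ {r n} (A : Matrix r n) → HasIndependentColumns A (rank A)
  -- The empty family is vacuously independent, which settles the default value 0.
  rank-attained {n = n} A = largest-satisfies (HasIndependentColumns A) n ((λ ()) , λ _ _ ())

  module _ {r n : ℕ} (A : Matrix r n) where

    rankOf : Subset n → ℕ
    rankOf S = rank (submatrix A S)

    -- This and `basis` translate between columns of `A` and positions in the list `elements S`.
    rankOf-upper : ∀ {S k} (f : Fin k → Fin n) → (∀ j → f j ∈ S) → Independent A f → k ℕ.≤ rankOf S
    rankOf-upper {S} f f∈S f-indep = rank-upper (submatrix A S)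
      ( (λ j → index (f∈elements j))
      , independent-resp-≗ A (λ j → lookup-index (f∈elements j)) f-indep )
      where
      f∈elements = λ j → ∈-filter⁺ (_∈? S) (∈-allFin (f j)) (f∈S j)

    -- Spanning follows from the size `rankOf S` being maximal, as `spans` proves.
    record Basis (S : Subset n) : Set (c ⊔ ℓ) where
      field
        column      : Fin (rankOf S) → Fin n
        column∈     : ∀ j → column j ∈ S
        independent : Independent A column

      -- A column of `T` outside the span would extend the basis of `S` to `suc (rankOf S)`
      -- independent columns of `T`.
      inSpan-unless-larger : ∀ {T i} → S ⊆ T → i ∈ T → rankOf T ℕ.≤ rankOf S → InSpan A column i
      inSpan-unless-larger {i = i} S⊆T i∈T ρT≤ρS with em {InSpan A column i}
      ... | yes i∈span = i∈span
      ... | no  i∉span = contradiction ρT≤ρS (ℕ.<⇒≱ (rankOf-upper (i ∷ column)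
              (λ { zero → i∈T ; (suc j) → S⊆T (column∈ j) })
              (independent-insert A independent i∉span)))

      spans : ∀ {i} → i ∈ S → InSpan A column i
      spans i∈S = inSpan-unless-larger id i∈S ℕ.≤-refl

    basis : ∀ S → Basis S
    basis S with rank-attained (submatrix A S)
    ... | f , f-indep = record
      { column      = λ j → lookup (elements S) (f j)
      ; column∈     = λ j → proj₂ (∈-filter⁻ (_∈? S) {xs = allFin n} (∈-lookup (f j)))
      ; independent = f-indep
      }

    rankOf-mono : ∀ {S T} → S ⊆ T → rankOf S ℕ.≤ rankOf T
    rankOf-mono {S} S⊆T = rankOf-upper column (S⊆T ∘ column∈) independent
      where open Basis (basis S)

    rankOf-spanned : ∀ {S k} (f : Fin k → Fin n) → (∀ {i} → i ∈ S → InSpan A f i) → rankOf S ℕ.≤ k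
    rankOf-spanned {S} f f-spans = ℕ.≮⇒≥ λ k<ρS →
      spanned-dependent A k<ρS (λ j → f-spans (column∈ j)) independent
      where open Basis (basis S)

    rank≤rankOf : ∀ {S} → (∀ i → i ∈ S) → rank A ℕ.≤ rankOf S
    rank≤rankOf all∈S with rank-attained A
    ... | f , f-indep = rankOf-upper f (all∈S ∘ f) f-indep

    -- A basis of `S` together with `i` spans the enlarged set.
    rankOf-insert : ∀ S i → rankOf (S ∪ ⁅ i ⁆) ℕ.≤ suc (rankOf S)
    rankOf-insert S i = rankOf-spanned (i ∷ column) λ x∈ →
      [ (λ x∈S → inSpan-tail A i (spans x∈S))
      , (λ x∈i → ≡.subst (InSpan A (i ∷ column)) (≡.sym (x∈⁅y⁆⇒x≡y i x∈i)) (inSpan-head A i column))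
      ]′ (x∈p∪q⁻ S ⁅ i ⁆ x∈)
      where open Basis (basis S)

    -- By contraposition: if `i` does not raise the rank of `S`, it lies in the span of a basis of
    -- `S`, hence in that of a basis of `T`, which then spans `T ∪ ⁅ i ⁆` too.
    rankOf-insert-< : ∀ {S T} i → S ⊆ T →
                      rankOf T ℕ.< rankOf (T ∪ ⁅ i ⁆) → rankOf S ℕ.< rankOf (S ∪ ⁅ i ⁆)
    rankOf-insert-< {S} {T} i S⊆T ρT<ρTi = ℕ.≰⇒> λ ρSi≤ρS → ℕ.<⇒≱ ρT<ρTi
      (rankOf-spanned T.column λ x∈ →
        [ T.spans
        , (λ x∈i → ≡.subst (InSpan A T.column) (≡.sym (x∈⁅y⁆⇒x≡y i x∈i))
            (inSpan-trans A
              (S.inSpan-unless-larger (p⊆p∪q ⁅ i ⁆) (q⊆p∪q S ⁅ i ⁆ (x∈⁅x⁆ i)) ρSi≤ρS)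
              (λ j → T.spans (S⊆T (S.column∈ j)))))
        ]′ (x∈p∪q⁻ T ⁅ i ⁆ x∈))
      where
      module S = Basis (basis S)
      module T = Basis (basis T)

    -- Cocircuits of a configuration of full row rank

    module _ (rankA≡r : rank A ≡ r) {C : Subset n} (cocircuit : Cocircuit A C) where

      -- Otherwise the enlarged set is coplanar, and maximality of `C` identifies it with `C`,
      -- although it contains `i`.
      cocircuit-insert : ∀ {i} → i ∉ C → r ℕ.≤ rankOf (C ∪ ⁅ i ⁆)
      cocircuit-insert {i} i∉C = ℕ.≮⇒≥ λ coplanar →
        i∉C (≡.subst (i ∈_) (proj₂ cocircuit (C ∪ ⁅ i ⁆) coplanar (p⊆p∪q ⁅ i ⁆))
                     (q⊆p∪q C ⁅ i ⁆ (x∈⁅x⁆ i)))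

      cocircuit-rank : r ℕ.∸ 1 ℕ.≤ rankOf C
      -- Some column lies outside `C`, for otherwise `C` would have the full rank `r` and not be
      -- coplanar.
      cocircuit-rank with Fin.¬∀⟶∃¬ n (_∈ C) (_∈? C) (λ all∈C →
                            ℕ.<⇒≱ (proj₁ cocircuit) (≡.subst (ℕ._≤ rankOf C) rankA≡r (rank≤rankOf all∈C)))
      ... | i , i∉C = ℕ.∸-monoˡ-≤ 1 (ℕ.≤-trans (cocircuit-insert i∉C) (rankOf-insert C i))

-- The reals form a field

-- The operations on reals act termwise, so this carries the ring laws over from the rationals.
≗⇒≈ℝ : ∀ x y → (∀ n → seq x n ≡ seq y n) → x ≈ℝ y
≗⇒≈ℝ x y x≗y ε 0<ε = 0 , λ n _ → ≡.subst (ℚ._< ε)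
  (≡.cong ∣_∣ (≡.sym (≡.trans (≡.cong (ℚ._- seq y n) (x≗y n)) (ℚ.+-inverseʳ (seq y n))))) 0<ε

∣p-q∣≡∣q-p∣ : ∀ p q → ∣ p ℚ.- q ∣ ≡ ∣ q ℚ.- p ∣
∣p-q∣≡∣q-p∣ p q = ≡.trans (≡.sym (ℚ.∣-p∣≡∣p∣ (p ℚ.- q)))
  (≡.cong ∣_∣ (solve 2 (λ a b → :- (a :- b) := b :- a) refl p q))
  where open +-*-Solver

∣p-r∣≤∣p-q∣+∣q-r∣ : ∀ p q r → ∣ p ℚ.- r ∣ ℚ.≤ ∣ p ℚ.- q ∣ ℚ.+ ∣ q ℚ.- r ∣
∣p-r∣≤∣p-q∣+∣q-r∣ p q r = ≡.subst (λ d → ∣ d ∣ ℚ.≤ ∣ p ℚ.- q ∣ ℚ.+ ∣ q ℚ.- r ∣)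
  (solve 3 (λ a b c → (a :- b) :+ (b :- c) := a :- c) refl p q r)
  (ℚ.∣p+q∣≤∣p∣+∣q∣ (p ℚ.- q) (q ℚ.- r))
  where open +-*-Solver

≈ℝ-sym : ∀ x y → x ≈ℝ y → y ≈ℝ x
≈ℝ-sym x y x≈y ε 0<ε with x≈y ε 0<ε
... | N , close = N , λ n N≤n → ≡.subst (ℚ._< ε) (∣p-q∣≡∣q-p∣ (seq x n) (seq y n)) (close n N≤n)

≈ℝ-trans : ∀ x y z → x ≈ℝ y → y ≈ℝ z → x ≈ℝ z
≈ℝ-trans x y z x≈y y≈z ε 0<ε with x≈y (½ ℚ.* ε) (0<½* 0<ε) | y≈z (½ ℚ.* ε) (0<½* 0<ε)
... | N , close₁ | M , close₂ = N ℕ.⊔ M , λ n N⊔M≤n →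
  ℚ.≤-<-trans (∣p-r∣≤∣p-q∣+∣q-r∣ (seq x n) (seq y n) (seq z n))
    (≡.subst (_ ℚ.<_) (halves ε)
      (ℚ.+-mono-< (close₁ n (ℕ.m⊔n≤o⇒m≤o N M N⊔M≤n)) (close₂ n (ℕ.m⊔n≤o⇒n≤o N M N⊔M≤n))))

+ℝ-cong : ∀ x x′ y y′ → x ≈ℝ x′ → y ≈ℝ y′ → (x +ℝ y) ≈ℝ (x′ +ℝ y′)
+ℝ-cong x x′ y y′ x≈x′ y≈y′ ε 0<ε with x≈x′ (½ ℚ.* ε) (0<½* 0<ε) | y≈y′ (½ ℚ.* ε) (0<½* 0<ε)
... | N , close₁ | M , close₂ = N ℕ.⊔ M , λ n N⊔M≤n →
  ≡.subst (ℚ._< ε)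
    (≡.cong ∣_∣ (solve 4 (λ a b c d → (a :- c) :+ (b :- d) := (a :+ b) :- (c :+ d))
                  refl (seq x n) (seq y n) (seq x′ n) (seq y′ n)))
    (ℚ.≤-<-trans (ℚ.∣p+q∣≤∣p∣+∣q∣ (seq x n ℚ.- seq x′ n) (seq y n ℚ.- seq y′ n))
      (≡.subst (_ ℚ.<_) (halves ε)
        (ℚ.+-mono-< (close₁ n (ℕ.m⊔n≤o⇒m≤o N M N⊔M≤n)) (close₂ n (ℕ.m⊔n≤o⇒n≤o N M N⊔M≤n)))))
  where open +-*-Solver

-ℝ-cong : ∀ x y → x ≈ℝ y → (-ℝ x) ≈ℝ (-ℝ y)
-ℝ-cong x y x≈y ε 0<ε with x≈y ε 0<ε
... | N , close = N , λ n N≤n → ≡.subst (ℚ._< ε)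
  (≡.trans (∣p-q∣≡∣q-p∣ (seq x n) (seq y n))
    (≡.cong ∣_∣ (solve 2 (λ a b → b :- a := (:- a) :- (:- b)) refl (seq x n) (seq y n))))
  (close n N≤n)
  where open +-*-Solver

-- The difference of the products is x (y - y′) + y′ (x - x′), so bounds `B` for `x` and `C` for
-- `y′` suffice, with δ = ε / (B + C).
*ℝ-cong : ∀ x x′ y y′ → x ≈ℝ x′ → y ≈ℝ y′ → (x *ℝ y) ≈ℝ (x′ *ℝ y′)
*ℝ-cong x x′ y y′ x≈x′ y≈y′ ε 0<ε
  with eventually-bounded {seq x} (cauchy x) | eventually-bounded {seq y′} (cauchy y′)
... | B , 0<B , N₁ , ∣x∣≤B | C , 0<C , N₂ , ∣y′∣≤C with scale (ℚ.+-mono-< 0<B 0<C) 0<ε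
...   | δ , 0<δ , total with x≈x′ δ 0<δ | y≈y′ δ 0<δ
...     | N₃ , close₁ | N₄ , close₂ = (N₁ ℕ.⊔ N₂) ℕ.⊔ (N₃ ℕ.⊔ N₄) , λ n N≤n →
  let n≥₁₂ = ℕ.m⊔n≤o⇒m≤o (N₁ ℕ.⊔ N₂) (N₃ ℕ.⊔ N₄) N≤n
      n≥₃₄ = ℕ.m⊔n≤o⇒n≤o (N₁ ℕ.⊔ N₂) (N₃ ℕ.⊔ N₄) N≤n
  in *-close (seq x n) (seq y n) (seq x′ n) (seq y′ n) 0<B 0<C total
       (∣x∣≤B n (ℕ.m⊔n≤o⇒m≤o N₁ N₂ n≥₁₂))
       (∣y′∣≤C n (ℕ.m⊔n≤o⇒n≤o N₁ N₂ n≥₁₂))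
       (close₂ n (ℕ.m⊔n≤o⇒n≤o N₃ N₄ n≥₃₄))
       (close₁ n (ℕ.m⊔n≤o⇒m≤o N₃ N₄ n≥₃₄))

-- Its raw ring unfolds to `ℝ-rawRing`, so `FieldRank` speaks of the same rank as the theorem.
ℝ-commutativeRing : CommutativeRing 0ℓ 0ℓ
ℝ-commutativeRing = record
  { Carrier = ℝ
  ; _≈_     = _≈ℝ_
  ; _+_     = _+ℝ_
  ; _*_     = _*ℝ_
  ; -_      = -ℝ_
  ; 0#      = 0ℝ
  ; 1#      = 1ℝ
  ; isCommutativeRing = record
    { isRing = record
      { +-isAbelianGroup = record
        { isGroup = record
          { isMonoid = record
            { isSemigroup = record
              { isMagma = record
                { isEquivalence = record
                  { refl  = λ {x} → ≗⇒≈ℝ x x λ _ → refl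
                  ; sym   = λ {x} {y} → ≈ℝ-sym x y
                  ; trans = λ {x} {y} {z} → ≈ℝ-trans x y z
                  }
                ; ∙-cong = λ {x} {x′} {y} {y′} → +ℝ-cong x x′ y y′
                }
              ; assoc = λ x y z → ≗⇒≈ℝ ((x +ℝ y) +ℝ z) (x +ℝ (y +ℝ z)) λ n →
                  ℚ.+-assoc (seq x n) (seq y n) (seq z n)
              }
            ; identity = (λ x → ≗⇒≈ℝ (0ℝ +ℝ x) x λ n → ℚ.+-identityˡ (seq x n))
                       , (λ x → ≗⇒≈ℝ (x +ℝ 0ℝ) x λ n → ℚ.+-identityʳ (seq x n))
            }
          ; inverse = (λ x → ≗⇒≈ℝ ((-ℝ x) +ℝ x) 0ℝ λ n → ℚ.+-inverseˡ (seq x n))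
                    , (λ x → ≗⇒≈ℝ (x +ℝ (-ℝ x)) 0ℝ λ n → ℚ.+-inverseʳ (seq x n))
          ; ⁻¹-cong = λ {x} {y} → -ℝ-cong x y
          }
        ; comm = λ x y → ≗⇒≈ℝ (x +ℝ y) (y +ℝ x) λ n → ℚ.+-comm (seq x n) (seq y n)
        }
      ; *-cong = λ {x} {x′} {y} {y′} → *ℝ-cong x x′ y y′
      ; *-assoc = λ x y z → ≗⇒≈ℝ ((x *ℝ y) *ℝ z) (x *ℝ (y *ℝ z)) λ n →
          ℚ.*-assoc (seq x n) (seq y n) (seq z n)
      ; *-identity = (λ x → ≗⇒≈ℝ (1ℝ *ℝ x) x λ n → ℚ.*-identityˡ (seq x n))
                   , (λ x → ≗⇒≈ℝ (x *ℝ 1ℝ) x λ n → ℚ.*-identityʳ (seq x n))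
      ; distrib = (λ x y z → ≗⇒≈ℝ (x *ℝ (y +ℝ z)) ((x *ℝ y) +ℝ (x *ℝ z)) λ n →
                    ℚ.*-distribˡ-+ (seq x n) (seq y n) (seq z n))
                , (λ x y z → ≗⇒≈ℝ ((y +ℝ z) *ℝ x) ((y *ℝ x) +ℝ (z *ℝ x)) λ n →
                    ℚ.*-distribʳ-+ (seq x n) (seq y n) (seq z n))
      }
    ; *-comm = λ x y → ≗⇒≈ℝ (x *ℝ y) (y *ℝ x) λ n → ℚ.*-comm (seq x n) (seq y n)
    }
  }
  where
  0ℝ = fromℚ 0ℚ
  1ℝ = fromℚ 1ℚ

-- Inverses of nonzero reals

AwayFromZero : (ℕ → ℚ) → ℕ → Set
AwayFromZero x N = ∃ λ δ → 0ℚ ℚ.< δ × (∀ n → N ℕ.≤ n → δ ℚ.≤ ∣ x n ∣)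

-- From `N` on, terms differ by less than ε/2. A single such term of absolute value at least ε would
-- keep all of them at distance at least ε/2 from zero.
¬away⇒≈0 : ∀ x → ¬ ∃ (AwayFromZero (seq x)) → x ≈ℝ fromℚ 0ℚ
¬away⇒≈0 x ¬away ε 0<ε with cauchy x (½ ℚ.* ε) (0<½* 0<ε)
... | N , close = N , λ n N≤n → ≡.subst (ℚ._< ε)
        (≡.cong ∣_∣ (≡.sym (ℚ.+-identityʳ (seq x n))))
        (ℚ.≰⇒> λ ε≤∣xₙ∣ → ¬away (N , ½ ℚ.* ε , 0<½* 0<ε , λ m N≤m →
          ℚ.≮⇒≥ λ ∣xₘ∣<ε/2 → ℚ.<-irrefl refl (begin-strict
            ε                                          ≤⟨ ε≤∣xₙ∣ ⟩
            ∣ seq x n ∣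
              ≡⟨ ≡.cong ∣_∣ (solve 2 (λ a b → a := (a :- b) :+ b) refl (seq x n) (seq x m)) ⟩
            ∣ (seq x n ℚ.- seq x m) ℚ.+ seq x m ∣
              ≤⟨ ℚ.∣p+q∣≤∣p∣+∣q∣ (seq x n ℚ.- seq x m) (seq x m) ⟩
            ∣ seq x n ℚ.- seq x m ∣ ℚ.+ ∣ seq x m ∣    <⟨ ℚ.+-mono-< (close n m N≤n N≤m) ∣xₘ∣<ε/2 ⟩
            ½ ℚ.* ε ℚ.+ ½ ℚ.* ε                        ≡⟨ halves ε ⟩
            ε                                          ∎)))
  where open ℚ.≤-Reasoning
        open +-*-Solver

away⇒nonZero : ∀ {δ q} → 0ℚ ℚ.< δ → δ ℚ.≤ ∣ q ∣ → ℚ.NonZero q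
away⇒nonZero {δ} 0<δ δ≤∣q∣ = ℚ.≢-nonZero λ q≡0 →
  ℚ.<-irrefl refl (ℚ.<-≤-trans 0<δ (≡.subst (λ q → δ ℚ.≤ ∣ q ∣) q≡0 δ≤∣q∣))

-- From a c = b d = 1 we get b − a = a b (c − d).
inverse-close : ∀ {δ ε a b c d} → 0ℚ ℚ.< δ → δ ℚ.≤ ∣ a ∣ → δ ℚ.≤ ∣ b ∣ →
                a ℚ.* c ≡ 1ℚ → b ℚ.* d ≡ 1ℚ →
                ∣ b ℚ.- a ∣ ℚ.< δ ℚ.* δ ℚ.* ε → ∣ c ℚ.- d ∣ ℚ.< ε
inverse-close {δ} {ε} {a} {b} {c} {d} 0<δ δ≤∣a∣ δ≤∣b∣ ac≡1 bd≡1 close =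
  ℚ.*-cancelˡ-<-nonNeg δ {{δ-nonNeg}} (ℚ.*-cancelˡ-<-nonNeg δ {{δ-nonNeg}} (begin-strict
    δ ℚ.* (δ ℚ.* ∣ e ∣)
      ≤⟨ ℚ.*-monoˡ-≤-nonNeg δ {{δ-nonNeg}} (ℚ.*-monoʳ-≤-nonNeg ∣ e ∣ {{ℚ.∣-∣-nonNeg e}} δ≤∣b∣) ⟩
    δ ℚ.* (∣ b ∣ ℚ.* ∣ e ∣)   ≡⟨ ≡.cong (δ ℚ.*_) (ℚ.∣p*q∣≡∣p∣*∣q∣ b e) ⟨
    δ ℚ.* ∣ b ℚ.* e ∣         ≤⟨ ℚ.*-monoʳ-≤-nonNeg ∣ b ℚ.* e ∣ {{ℚ.∣-∣-nonNeg (b ℚ.* e)}} δ≤∣a∣ ⟩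
    ∣ a ∣ ℚ.* ∣ b ℚ.* e ∣     ≡⟨ ℚ.∣p*q∣≡∣p∣*∣q∣ a (b ℚ.* e) ⟨
    ∣ a ℚ.* (b ℚ.* e) ∣       ≡⟨ ≡.cong ∣_∣ cleared ⟩
    ∣ b ℚ.- a ∣               <⟨ close ⟩
    δ ℚ.* δ ℚ.* ε             ≡⟨ ℚ.*-assoc δ δ ε ⟩
    δ ℚ.* (δ ℚ.* ε)           ∎))
  where
  open ℚ.≤-Reasoning
  e = c ℚ.- d
  δ-nonNeg = nonNegative (ℚ.<⇒≤ 0<δ)
  cleared : a ℚ.* (b ℚ.* e) ≡ b ℚ.- a
  cleared = ≡.trans
    (solve 4 (λ a b c d → a :* (b :* (c :- d)) := b :* (a :* c) :- a :* (b :* d)) refl a b c d)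
    (≡.cong₂ ℚ._-_ (≡.trans (≡.cong (b ℚ.*_) ac≡1) (ℚ.*-identityʳ b))
                   (≡.trans (≡.cong (a ℚ.*_) bd≡1) (ℚ.*-identityʳ a)))
    where open +-*-Solver

-- The difference of two reciprocals is the difference of the terms divided by their product, whose
-- absolute value is at least δδ. Hence the tolerance δδε for `x`.
inverse-cauchy : ∀ {δ x y} → 0ℚ ℚ.< δ → (∀ n → δ ℚ.≤ ∣ x n ∣) → (∀ n → x n ℚ.* y n ≡ 1ℚ) →
                 IsCauchy x → IsCauchy y
inverse-cauchy {δ} 0<δ δ≤∣x∣ xy≡1 cx ε 0<ε with cx (δ ℚ.* δ ℚ.* ε) 0<δδε
  where
  0<* : ∀ {p q} → 0ℚ ℚ.< p → 0ℚ ℚ.< q → 0ℚ ℚ.< p ℚ.* q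
  0<* {p} {q} 0<p 0<q = ≡.subst (ℚ._< p ℚ.* q) (ℚ.*-zeroʳ p) (ℚ.*-monoʳ-<-pos p {{positive 0<p}} 0<q)
  0<δδε = 0<* (0<* 0<δ 0<δ) 0<ε
... | N , close = N , λ m n N≤m N≤n →
        inverse-close 0<δ (δ≤∣x∣ m) (δ≤∣x∣ n) (xy≡1 m) (xy≡1 n) (close n m N≤n N≤m)

-- Early terms may vanish, so the sequence is shifted by `N` before reciprocals are taken termwise.
-- Being Cauchy, it represents the same real as its shift.
invertible : ∀ x → ∃ (AwayFromZero (seq x)) → ∃ λ y → (x *ℝ y) ≈ℝ fromℚ 1ℚ
invertible x (N , δ , 0<δ , away) = y ,
  ≈ℝ-trans (x *ℝ y) (x′ *ℝ y) (fromℚ 1ℚ)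
    (*ℝ-cong x x′ y y x≈x′ (≗⇒≈ℝ y y λ _ → refl))
    (≗⇒≈ℝ (x′ *ℝ y) (fromℚ 1ℚ) inverse)
  where
  tail : ℕ → ℚ
  tail n = seq x (N ℕ.+ n)

  tail-cauchy : IsCauchy tail
  tail-cauchy ε 0<ε with cauchy x ε 0<ε
  ... | M , close = M , λ m n M≤m M≤n → close _ _ (ℕ.m≤n⇒m≤o+n N M≤m) (ℕ.m≤n⇒m≤o+n N M≤n)

  x′ : ℝ
  x′ = mkℝ tail tail-cauchy

  x≈x′ : x ≈ℝ x′
  x≈x′ ε 0<ε with cauchy x ε 0<ε
  ... | M , close = M , λ n M≤n → close _ _ M≤n (ℕ.m≤n⇒m≤o+n N M≤n)

  tail-away : ∀ n → δ ℚ.≤ ∣ tail n ∣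
  tail-away n = away (N ℕ.+ n) (ℕ.m≤m+n N n)

  reciprocal : ℕ → ℚ
  reciprocal n = (1/ tail n) {{away⇒nonZero 0<δ (tail-away n)}}

  inverse : ∀ n → tail n ℚ.* reciprocal n ≡ 1ℚ
  inverse n = ℚ.*-inverseʳ (tail n) {{away⇒nonZero 0<δ (tail-away n)}}

  y : ℝ
  y = mkℝ reciprocal (inverse-cauchy {δ} {tail} {reciprocal} 0<δ tail-away inverse tail-cauchy)

1≉0ℝ : ¬ (fromℚ 1ℚ ≈ℝ fromℚ 0ℚ)
1≉0ℝ 1≈0 with 1≈0 1ℚ (ℚ.positive⁻¹ 1ℚ)
... | N , close = ℚ.<-irrefl refl (close N ℕ.≤-refl)

ℝ-isField : ExcludedMiddle 0ℓ → IsField ℝ-commutativeRing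
ℝ-isField em = record
  { 1≉0              = 1≉0ℝ
  ; zeroOrInvertible = zeroOrInvertible
  }
  where
  zeroOrInvertible : ∀ x → x ≈ℝ fromℚ 0ℚ ⊎ ∃ λ y → (x *ℝ y) ≈ℝ fromℚ 1ℚ
  zeroOrInvertible x with em {∃ (AwayFromZero (seq x))}
  ... | yes away = inj₂ (invertible x away)
  ... | no ¬away = inj₁ (¬away⇒≈0 x ¬away)

-- Right-completable sets

max-∈ : ∀ {n} (S : Subset n) {m} → max S ≡ just m → m ∈ S
max-∈ (b Vec.∷ S) max≡ with max S in eq
max-∈ (b       Vec.∷ S) refl | just m  = Vec.there (max-∈ S eq)
max-∈ (inside  Vec.∷ S) refl | nothing = Vec.here
max-∈ (outside Vec.∷ S) ()   | nothing

∈-above : ∀ {n} {m i : Fin n} → m < i → i ∈ above (just m)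
∈-above {m = m} {i} m<i = Vec.lookup⇒[]= i _
  (≡.trans (Vec.lookup∘tabulate _ i) (dec-true (m Fin.<? i) m<i))

-- Elements of `C` outside `S` exceed all of `S`, in particular its maximum.
⊆∪above : ∀ {n} {S C : Subset n} → RightCompletable S C → C ⊆ S ∪ above (max S)
⊆∪above {S = S} (_ , C∖S-above) {i} i∈C with i ∈? S
... | yes i∈S = p⊆p∪q (above (max S)) i∈S
... | no  i∉S with max S in eq
-- Here `S` has no maximum, and `above nothing` is the whole index set.
...   | nothing = q⊆p∪q S _ ∈⊤
...   | just m  = q⊆p∪q S _ (∈-above (C∖S-above i∈C i∉S (max-∈ S eq)))

theorem6 : (em : ExcludedMiddle 0ℓ) →
  let open RealMatrices
      open Rank em
  in
  ∀ {r n} (A : Matrix r n) → rank A ≡ r →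
  (S C₀ : Subset n) → Cocircuit A C₀ → RightCompletable S C₀ →
    (rank (submatrix A (S ∪ above (max S))) ℕ.≥ r ℕ.∸ 1)
    ×
    (∀ m → max S ≡ just m → ∀ i → i ∉ S → i < m →
      rank (submatrix A S) ℕ.< rank (submatrix A (S ∪ ⁅ i ⁆)))
theorem6 em A rankA≡r S C₀ cocircuit completable =
    ℕ.≤-trans (cocircuit-rank A rankA≡r cocircuit) (rankOf-mono A (⊆∪above completable))
  , λ m max≡m i i∉S i<m →
      let i∉C₀ = λ i∈C₀ → Fin.<-asym i<m (proj₂ completable i∈C₀ i∉S (max-∈ S max≡m))
      in rankOf-insert-< A i (proj₁ completable)
           -- The rank of `C₀` is below `r`, and that of `C₀ ∪ ⁅ i ⁆` is at least `r`.
           (ℕ.<-≤-trans (proj₁ cocircuit) (cocircuit-insert A rankA≡r cocircuit i∉C₀))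
  where open FieldRank ℝ-commutativeRing (ℝ-isField em) em
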